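{- Let $\mathbf{DLat}$ be the class of bounded distributive lattices. Then: (i) $\mathbf{DLat}=\omega_0\mathbf{JD}=\omega_0\mathbf{Frm}$; (ii) for regular cardinals $\lambda\le\kappa$, $\kappa\mathbf{JD}\subseteq\lambda\mathbf{JD}$ and $\kappa\mathbf{Frm}\subseteq\lambda\mathbf{Frm}$, and both inclusions are proper when $\lambda<\kappa$; (iii) $\kappa\mathbf{Frm}\subseteq\kappa\mathbf{JD}$ for every regular $\kappa$, and this inclusion is proper for $\kappa>\omega_0$; (iv) $\mathbf{JID}=\bigcap_\kappa\kappa\mathbf{JD}$ and $\mathbf{Frm}=\bigcap_\kappa\kappa\mathbf{Frm}$, the intersections ranging over all regular cardinals.
   Context: For a regular cardinal $\kappa$, a $\kappa$-join is a join of a set of cardinality $<\kappa$; $\omega_0$ denotes the first infinite cardinal. An existing join $\bigvee S$ in a lattice $A$ is distributive if $a\wedge\bigvee S=\bigvee\{a\wedge s:s\in S\}$ for all $a\in A$. $\kappa\mathbf{JD}$ is the class of bounded distributive lattices in which every existing $\kappa$-join is distributive; $\kappa\mathbf{Frm}$ is the class of bounded distributive lattices in which all $\kappa$-joins exist and are distributive ($\kappa$-frames); $\mathbf{JID}$ is the class of bounded distributive lattices in which every existing join is distributive; $\mathbf{Frm}$ is the class of frames. -}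

module Defs where

open import Level using (Level; Lift; Setω; suc; _⊔_)
open import Algebra.Core using (Op₂)
open import Algebra.Definitions using (_DistributesOverˡ_)
open import Axiom.ExcludedMiddle using (ExcludedMiddle)
open import Axiom.Extensionality.Propositional using (Extensionality)
open import Data.Nat.Base using (ℕ)
open import Data.Product.Base using (Σ; ∃; _×_; proj₁)
open import Function.Bundles using (Func; Injection)
open import Relation.Binary.Bundles using (Setoid)
open import Relation.Binary.Core using (Rel)
open import Relation.Binary.Lattice.Bundles using (BoundedLattice)
open import Relation.Binary.Lattice.Structures using (IsBoundedLattice)
import Relation.Binary.Construct.On as On
import Relation.Binary.PropositionalEquality as ≡
open import Relation.Nullary.Negation.Core using (¬_)
open import Relation.Unary using (Pred; U; _∈_)

-- The ambient classical set theory, an assumption of the theorem rather than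
-- an axiom of the development.  `Dec P` for arbitrary types P already selects
-- an element of every nonempty type; applied to Bool-valued subsets, which
-- extensionality identifies when they have the same elements, it gives the
-- axiom of choice for setoids (every surjection has a congruent section).
record Classical : Setω where
  field
    excludedMiddle : ∀ a → ExcludedMiddle a
    extensionality : ∀ a b → Extensionality a b

-- "Set" means setoid.  A cardinal is given by any setoid of that cardinality;
-- ≼ and ≺ compare cardinalities.

module _ {ℓ : Level} where

  infix 4 _≼_ _≺_

  _≼_ : Rel (Setoid ℓ ℓ) ℓ
  X ≼ Y = Injection X Y

  _≺_ : Rel (Setoid ℓ ℓ) ℓ
  X ≺ Y = X ≼ Y × ¬ (Y ≼ X)

  -- A predicate need not respect the equality of X: it denotes the set of
  -- equality classes it meets, and ⟦ X ∣ S ⟧ has the cardinality of that set.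
  ⟦_∣_⟧ : (X : Setoid ℓ ℓ) → Pred (Setoid.Carrier X) ℓ → Setoid ℓ ℓ
  ⟦ X ∣ S ⟧ = On.setoid X (proj₁ {B = S})

  fibre : {X I : Setoid ℓ ℓ} → Func X I → Setoid.Carrier I → Setoid ℓ ℓ
  fibre {X} {I} f i = ⟦ X ∣ (λ x → Setoid._≈_ I (Func.to f x) i) ⟧

  ω₀ : Setoid ℓ ℓ
  ω₀ = ≡.setoid (Lift ℓ ℕ)

  -- κ is infinite and is not a sum of fewer than κ cardinals below κ; a
  -- decomposition of κ indexed by I is a map κ → I, with the fibres as summands.
  record IsRegular (κ : Setoid ℓ ℓ) : Set (suc ℓ) where
    field
      infinite : ω₀ ≼ κ
      regular  : (I : Setoid ℓ ℓ) → I ≺ κ → (f : Func κ I) →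
                 ¬ (∀ i → fibre f i ≺ κ)

RegularCardinal : (ℓ : Level) → Set (suc ℓ)
RegularCardinal ℓ = Σ (Setoid ℓ ℓ) IsRegular

record BoundedDistributiveLattice c ℓ₁ ℓ₂ : Set (suc (c ⊔ ℓ₁ ⊔ ℓ₂)) where
  infix  4 _≈_ _≤_
  infixr 6 _∨_
  infixr 7 _∧_
  field
    Carrier          : Set c
    _≈_              : Rel Carrier ℓ₁
    _≤_              : Rel Carrier ℓ₂
    _∨_              : Op₂ Carrier
    _∧_              : Op₂ Carrier
    ⊤                : Carrier
    ⊥                : Carrier
    isBoundedLattice : IsBoundedLattice _≈_ _≤_ _∨_ _∧_ ⊤ ⊥
    ∧-distribˡ-∨     : _DistributesOverˡ_ _≈_ _∧_ _∨_

  boundedLattice : BoundedLattice c ℓ₁ ℓ₂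
  boundedLattice = record { isBoundedLattice = isBoundedLattice }

  open BoundedLattice boundedLattice public
    hiding (Carrier; _≈_; _≤_; _∨_; _∧_; ⊤; ⊥; isBoundedLattice)

module Joins {ℓ : Level} (A : BoundedDistributiveLattice ℓ ℓ ℓ) where
  open BoundedDistributiveLattice A

  record IsJoin (S : Pred Carrier ℓ) (j : Carrier) : Set ℓ where
    field
      upper : ∀ {s} → s ∈ S → s ≤ j
      least : ∀ {u} → (∀ {s} → s ∈ S → s ≤ u) → j ≤ u

  infixr 7 _∧ˢ_

  _∧ˢ_ : Carrier → Pred Carrier ℓ → Pred Carrier ℓ
  (a ∧ˢ S) x = ∃ λ s → s ∈ S × x ≈ a ∧ s

  IsDistributiveJoin : Pred Carrier ℓ → Carrier → Set ℓ
  IsDistributiveJoin S j = ∀ a → IsJoin (a ∧ˢ S) (a ∧ j)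

module _ {ℓ : Level} where

  private
    BDL : Set (suc ℓ)
    BDL = BoundedDistributiveLattice ℓ ℓ ℓ

  infix 25 _-JD _-Frm

  DLat : Pred BDL _
  DLat = U

  _-JD : Setoid ℓ ℓ → Pred BDL (suc ℓ)
  (κ -JD) A = ∀ S → ⟦ setoid ∣ S ⟧ ≺ κ → ∀ j → IsJoin S j → IsDistributiveJoin S j
    where
    open BoundedDistributiveLattice A using (setoid)
    open Joins A

  _-Frm : Setoid ℓ ℓ → Pred BDL (suc ℓ)
  (κ -Frm) A = ∀ S → ⟦ setoid ∣ S ⟧ ≺ κ → ∃ λ j → IsJoin S j × IsDistributiveJoin S j
    where
    open BoundedDistributiveLattice A using (setoid)
    open Joins A

  JID : Pred BDL (suc ℓ)
  JID A = ∀ S j → IsJoin S j → IsDistributiveJoin S j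
    where open Joins A

  Frm : Pred BDL (suc ℓ)
  Frm A = ∀ S → ∃ λ j → IsJoin S j × IsDistributiveJoin S j
    where open Joins A

{-# OPTIONS --safe #-}
module Submission where

-- The inclusions are formal.  A set smaller than ω₀ has a bounded injection into
-- ℕ, so its join is a finite one, and finite joins distribute.
--
-- For μ < κ, the subsets of μ of size < μ together with μ itself form a μ-frame,
-- μ being regular.  Here ⊤ is the join of all singletons but {p}; meeting with
-- {p} shows that this join of μ < κ elements is not distributive.
--
-- For κ > ω₀, the eventually constant functions ℕ × Bool → Bool form a Boolean
-- algebra, where existing joins distribute; the points (n , true) have no join,
-- as an upper bound contains some (n , false), which can be removed from it.
--
-- For the intersections, every set X lies below a regular cardinal: embed X in a
-- set Y with |Y| · |Y| ≤ |Y| and let κ be the set of ordinals of trees branching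
-- over Y.  Proper initial segments of κ embed in Y, but κ does not, so by
-- comparability every I < κ embeds in Y; if κ were a union of fewer than κ sets
-- below κ, then κ would embed in Y × Y, hence in Y.

open import Defs
open import Axiom.ExcludedMiddle using (ExcludedMiddle)
open import Data.Bool.Base using (Bool; true; false; T; _∧_; _∨_; not; if_then_else_)
open import Data.Bool.Properties as Bool using (T-∧; T-∨)
import Data.Empty.Polymorphic as Empty
open import Data.Maybe.Base using (Maybe; just; nothing)
open import Data.Nat.Base as ℕ using (ℕ; zero; suc)
import Data.Nat.Properties as ℕ
open import Data.Product.Base using (∃; ∃₂; _×_; _,_; proj₁; proj₂; map₂)
open import Data.Sum.Base as Sum using (_⊎_; inj₁; inj₂; [_,_]′)
import Data.Unit.Polymorphic.Base as Unit
open import Function.Base using (_∘_; const; id; flip; _on_)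
open import Function.Bundles using (Func; Injection; Equivalence; mk⇔)
open import Function.Construct.Composition using (injection)
open import Induction.WellFounded
  using (WellFounded; Acc; acc; WfRec; module All; module FixPoint; wf⇒irrefl)
open import Level using (Level; Lift; lift; lower)
open import Relation.Binary.Bundles using (Poset; Setoid)
open import Relation.Binary.Core using (Rel)
open import Relation.Binary.Definitions using (tri<; tri≈; tri>)
import Relation.Binary.Lattice.Properties.MeetSemilattice as MeetSemilatticeProperties
open import Relation.Binary.PropositionalEquality as ≡
  using (_≡_; refl; cong)
open import Relation.Nullary.Decidable
  using (yes; no; ⌊_⌋; does; does-⇔; isYes≗does; toWitness; fromWitness;
         decidable-stable; toSum)
open import Relation.Nullary.Negation using (¬_; contradiction)
open import Relation.Unary using (Pred; _∈_; _≐_; _⊆_; _⊂_; ⋂)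

open Setoid using (Carrier)

private
  ∧⁺ : ∀ {x y} → T x × T y → T (x ∧ y)
  ∧⁺ = Equivalence.from T-∧

  ∧⁻ : ∀ {x y} → T (x ∧ y) → T x × T y
  ∧⁻ = Equivalence.to T-∧

  ∨⁺ : ∀ {x y} → T x ⊎ T y → T (x ∨ y)
  ∨⁺ = Equivalence.from T-∨

  ∨⁻ : ∀ {x y} → T (x ∨ y) → T x ⊎ T y
  ∨⁻ = Equivalence.to T-∨

-- Comparison of cardinalities.

module _ {ℓ : Level} where

  ≼-trans : {X Y Z : Setoid ℓ ℓ} → X ≼ Y → Y ≼ Z → X ≼ Z
  ≼-trans = injection

  ≼-≺-trans : {X Y Z : Setoid ℓ ℓ} → X ≼ Y → Y ≺ Z → X ≺ Z
  ≼-≺-trans X≼Y (Y≼Z , Z⋠Y) =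
    ≼-trans X≼Y Y≼Z , λ Z≼X → Z⋠Y (≼-trans Z≼X X≼Y)

  ≺-≼-trans : {X Y Z : Setoid ℓ ℓ} → X ≺ Y → Y ≼ Z → X ≺ Z
  ≺-≼-trans (X≼Y , Y⋠X) Y≼Z =
    ≼-trans X≼Y Y≼Z , λ Z≼X → Y⋠X (≼-trans Y≼Z Z≼X)

  subset-≼ : (X : Setoid ℓ ℓ) (S : Pred (Carrier X) ℓ) → ⟦ X ∣ S ⟧ ≼ X
  subset-≼ X S = record { to = proj₁ ; cong = id ; injective = id }

  subset-mono : (X : Setoid ℓ ℓ) {S T : Pred (Carrier X) ℓ} →
                S ⊆ T → ⟦ X ∣ S ⟧ ≼ ⟦ X ∣ T ⟧
  subset-mono X S⊆T = record { to = map₂ S⊆T ; cong = id ; injective = id }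

  empty-≼ : (X Y : Setoid ℓ ℓ) → ¬ Carrier X → X ≼ Y
  empty-≼ X Y ¬X = record
    { to = λ x → contradiction x ¬X
    ; cong = λ {x} _ → contradiction x ¬X
    ; injective = λ {x} _ → contradiction x ¬X
    }

  subsingleton-≼ : (X Y : Setoid ℓ ℓ) → (∀ x x′ → Setoid._≈_ X x x′) →
                   Carrier Y → X ≼ Y
  subsingleton-≼ X Y all≈ y = record
    { to = const y ; cong = λ _ → Setoid.refl Y ; injective = λ _ → all≈ _ _ }

  -- Each element of the image carries a preimage, so projecting to it needs no choice. Injectivity
  -- of `f` makes the projection well defined, congruence of `f` makes it injective.
  image-≼ : (X Y : Setoid ℓ ℓ) (f : Carrier X → Carrier Y) →
            (∀ {x x′} → Setoid._≈_ X x x′ → Setoid._≈_ Y (f x) (f x′)) →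
            (∀ {x x′} → Setoid._≈_ Y (f x) (f x′) → Setoid._≈_ X x x′) →
            ⟦ Y ∣ (λ y → ∃ λ x → Setoid._≈_ Y y (f x)) ⟧ ≼ X
  image-≼ X Y f f-cong f-injective = record
    { to = λ (_ , x , _) → x
    ; cong = λ {(_ , _ , y≈fx)} {(_ , _ , y′≈fx′)} y≈y′ →
        f-injective (trans (sym y≈fx) (trans y≈y′ y′≈fx′))
    ; injective = λ {(_ , _ , y≈fx)} {(_ , _ , y′≈fx′)} x≈x′ →
        trans y≈fx (trans (f-cong x≈x′) (sym y′≈fx′))
    }
    where open Setoid Y using (sym; trans)

-- Choice from excluded middle and extensionality.

module Choice {ℓ : Level} (C : Classical) where

  em : ∀ {a} → ExcludedMiddle a
  em = Classical.excludedMiddle C _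

  by-contradiction : ∀ {a} {P : Set a} → ¬ ¬ P → P
  by-contradiction = decidable-stable em

  χ : {A : Set ℓ} → Pred A ℓ → A → Bool
  χ P x = ⌊ em {P = P x} ⌋

  T-χ⁻ : {A : Set ℓ} (P : Pred A ℓ) {x : A} → T (χ P x) → x ∈ P
  T-χ⁻ P = toWitness

  T-χ⁺ : {A : Set ℓ} (P : Pred A ℓ) {x : A} → x ∈ P → T (χ P x)
  T-χ⁺ P = fromWitness

  -- Function extensionality enters the proof only here: predicates with the same elements get
  -- literally equal characteristic functions.
  χ-cong : {A : Set ℓ} {P Q : Pred A ℓ} → P ≐ Q → χ P ≡ χ Q
  χ-cong (P⊆Q , Q⊆P) =
    Classical.extensionality C _ _ λ _ → begin
      ⌊ em ⌋    ≡⟨ isYes≗does em ⟩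
      does em   ≡⟨ does-⇔ (mk⇔ P⊆Q Q⊆P) em em ⟩
      does em   ≡⟨ isYes≗does em ⟨
      ⌊ em ⌋    ∎
    where open ≡.≡-Reasoning

  -- Choosing from χ P instead of P makes the choice depend only on the elements
  -- of P.
  private
    pick : {A : Set ℓ} → A → (A → Bool) → A
    pick a f with em {P = ∃ (T ∘ f)}
    ... | yes (x , _) = x
    ... | no  _       = a

    pick-T : {A : Set ℓ} (a : A) (f : A → Bool) → ∃ (T ∘ f) → T (f (pick a f))
    pick-T a f w with em {P = ∃ (T ∘ f)}
    ... | yes (_ , t) = t
    ... | no  ¬w      = contradiction w ¬w

    pick-irrelevant : {A : Set ℓ} (a b : A) (f : A → Bool) → ∃ (T ∘ f) →
                      pick a f ≡ pick b f
    pick-irrelevant a b f w with em {P = ∃ (T ∘ f)}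
    ... | yes _ = refl
    ... | no ¬w = contradiction w ¬w

  choose : {A : Set ℓ} → A → Pred A ℓ → A
  choose a P = pick a (χ P)

  choose-∈ : {A : Set ℓ} (a : A) (P : Pred A ℓ) → ∃ P → choose a P ∈ P
  choose-∈ a P (x , x∈P) = T-χ⁻ P (pick-T a (χ P) (x , T-χ⁺ P x∈P))

  choose-cong : {A : Set ℓ} (a : A) {P Q : Pred A ℓ} → P ≐ Q →
                choose a P ≡ choose a Q
  choose-cong a P≐Q = cong (pick a) (χ-cong P≐Q)

  choose-irrelevant : {A : Set ℓ} (a b : A) (P : Pred A ℓ) → ∃ P →
                      choose a P ≡ choose b P
  choose-irrelevant a b P (x , x∈P) = pick-irrelevant a b (χ P) (x , T-χ⁺ P x∈P)

  -- Equal indices have predicates with the same elements, hence equal choices. The defaults taken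
  -- from `total` may still differ, and `choose-irrelevant` removes that difference.
  choice : (X : Setoid ℓ ℓ) {A : Set ℓ} (R : Carrier X → Pred A ℓ) →
           (∀ {x y} → Setoid._≈_ X x y → R x ⊆ R y) → (∀ x → ∃ (R x)) →
           ∃ λ (f : Carrier X → A) →
             (∀ x → f x ∈ R x) × (∀ {x y} → Setoid._≈_ X x y → f x ≡ f y)
  choice X R R-resp total =
    (λ x → choose (proj₁ (total x)) (R x)) ,
    (λ x → choose-∈ _ (R x) (total x)) ,
    λ {x} {y} x≈y → ≡.trans
      (choose-cong _ (R-resp x≈y , R-resp (Setoid.sym X x≈y)))
      (choose-irrelevant _ _ (R y) (total y))

  choice-≼ : (X Y : Setoid ℓ ℓ) (R : Carrier X → Pred (Carrier Y) ℓ) →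
             (∀ {x x′} → Setoid._≈_ X x x′ → R x ⊆ R x′) →
             (∀ x → ∃ (R x)) →
             (∀ {x x′ y y′} → R x y → R x′ y′ →
               Setoid._≈_ Y y y′ → Setoid._≈_ X x x′) →
             X ≼ Y
  choice-≼ X Y R R-resp total R-inj =
    let f , f∈ , f-cong = choice X R R-resp total in record
    { to = f
    ; cong = λ x≈x′ → Setoid.reflexive Y (f-cong x≈x′)
    ; injective = R-inj (f∈ _) (f∈ _)
    }

-- A regular cardinal above a given set.

module Hartogs {ℓ : Level} (C : Classical) (X : Setoid ℓ ℓ) where
  open Choice {ℓ} C

  -- A type closed under pairing, so that |Tree| · |Tree| ≤ |Tree|.
  data Tree : Set ℓ where
    leaf : Carrier X → Tree
    nil  : Tree
    node : Maybe Tree → Tree → Tree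

  Y : Setoid ℓ ℓ
  Y = ≡.setoid Tree

  -- Trees are compared by propositional equality, so a representative of each class of `X` has to
  -- be chosen before `leaf` is applied.
  X≼Y : X ≼ Y
  X≼Y = choice-≼ X Y (λ x t → ∃ λ x′ → Setoid._≈_ X x x′ × t ≡ leaf x′)
    (λ x≈y (z , x≈z , eq) → z , Setoid.trans X (Setoid.sym X x≈y) x≈z , eq)
    (λ x → leaf x , x , Setoid.refl X , refl)
    λ { (z , x≈z , refl) (_ , x′≈z , refl) refl →
        Setoid.trans X x≈z (Setoid.sym X x′≈z) }

  ω₀≼Y : ω₀ ≼ Y
  ω₀≼Y = record
    { to = comb ∘ lower
    ; cong = cong (comb ∘ lower)
    ; injective = cong lift ∘ comb-injective _ _
    }
    where
    comb : ℕ → Tree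
    comb zero    = nil
    comb (suc n) = node nothing (comb n)

    comb-injective : ∀ m n → comb m ≡ comb n → m ≡ n
    comb-injective zero    zero    _  = refl
    comb-injective (suc m) (suc n) eq =
      cong suc (comb-injective m n (node-injective eq))
      where
      node-injective : ∀ {m s t} → node m s ≡ node m t → s ≡ t
      node-injective refl = refl

  -- An element is coded by `node`, which pairs the index of a chosen piece containing it with its
  -- code within that piece. The extra index `nothing` makes room for one more piece than there are
  -- trees.
  union-≼ : (Z : Setoid ℓ ℓ) (P : Maybe Tree → Pred (Carrier Z) ℓ) →
            (∀ m {z z′} → Setoid._≈_ Z z z′ → P m z → P m z′) →
            (∀ z → ∃ λ m → P m z) → (∀ m → ⟦ Z ∣ P m ⟧ ≼ Y) → Z ≼ Y
  union-≼ Z P P-resp cover small =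
    let f , f∈ , f-cong = choice Z (flip P) (λ z≈z′ {m} → P-resp m z≈z′) cover in record
    { to = λ z → node (f z) (Injection.to (small (f z)) (z , f∈ z))
    ; cong = λ z≈z′ → to-cong (f-cong z≈z′) z≈z′
    ; injective = λ eq → to-injective eq
    }
    where
    to-cong : ∀ {m m′ z z′} {p : P m z} {p′ : P m′ z′} → m ≡ m′ →
              Setoid._≈_ Z z z′ →
              node m (Injection.to (small m) (z , p)) ≡
              node m′ (Injection.to (small m′) (z′ , p′))
    to-cong {m} refl z≈z′ = cong (node m) (Injection.cong (small m) z≈z′)

    node-injective : ∀ {m m′ s s′} → node m s ≡ node m′ s′ → m ≡ m′ × s ≡ s′
    node-injective refl = refl , refl

    to-injective : ∀ {m m′ z z′} {p : P m z} {p′ : P m′ z′} →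
                   node m (Injection.to (small m) (z , p)) ≡
                   node m′ (Injection.to (small m′) (z′ , p′)) →
                   Setoid._≈_ Z z z′
    to-injective {m} eq with refl , eq′ ← node-injective eq =
      Injection.injective (small m) eq′

  data Ord : Set ℓ where
    zero : Ord
    sup  : (Tree → Ord) → Ord

  infix 4 _≤_ _<_ _≈_

  -- sup f is the least ordinal above all f y; the order compares ranks.
  mutual
    _≤_ : Rel Ord ℓ
    zero  ≤ t = Unit.⊤
    sup f ≤ t = ∀ y → f y < t

    _<_ : Rel Ord ℓ
    s < zero  = Empty.⊥
    s < sup g = ∃ λ y → s ≤ g y

  _≈_ : Rel Ord ℓ
  s ≈ t = s ≤ t × t ≤ s

  ≤-refl : ∀ {s} → s ≤ s
  ≤-refl {zero}  = _
  ≤-refl {sup f} = λ y → y , ≤-refl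

  mutual
    ≤-trans : ∀ {s t u} → s ≤ t → t ≤ u → s ≤ u
    ≤-trans {zero}  p q = _
    ≤-trans {sup f} p q = λ y → <-≤-trans (p y) q

    <-≤-trans : ∀ {s t u} → s < t → t ≤ u → s < u
    <-≤-trans {t = sup g} (y , s≤gy) q = ≤-<-trans s≤gy (q y)

    ≤-<-trans : ∀ {s t u} → s ≤ t → t < u → s < u
    ≤-<-trans {u = sup h} p (y , t≤hy) = y , ≤-trans p t≤hy

  <⇒≤ : ∀ {s t} → s < t → s ≤ t
  <⇒≤ {zero}              _       = _
  <⇒≤ {sup f} {sup g} (y , p) = λ x → y , <⇒≤ (p x)

  -- If no branch of `sup f` reaches `t`, induction with the arguments swapped puts every branch
  -- strictly below `t`.
  ≤-total : ∀ s t → s ≤ t ⊎ t < s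
  ≤-total zero    t = inj₁ _
  ≤-total (sup f) t with em {P = ∃ λ y → t ≤ f y}
  ... | yes t<sup = inj₂ t<sup
  ... | no  t≮sup = inj₁ λ y →
    [ (λ t≤fy → contradiction (y , t≤fy) t≮sup) , id ]′ (≤-total t (f y))

  -- The order compares ranks and not subtrees, so the structural induction is on an upper bound `t`
  -- and covers all ordinals of rank at most that of `t`.
  <-wellFounded : WellFounded _<_
  <-wellFounded t = ≤-acc t ≤-refl
    where
    ≤-acc : ∀ t {s} → s ≤ t → Acc _<_ s
    ≤-acc zero    s≤t = acc λ r<s → Empty.⊥-elim (<-≤-trans r<s s≤t)
    ≤-acc (sup g) s≤t = acc λ r<s →
      let y , r≤gy = <-≤-trans r<s s≤t in ≤-acc (g y) r≤gy

  κ : Setoid ℓ ℓ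
  κ = record
    { Carrier = Ord
    ; _≈_ = _≈_
    ; isEquivalence = record
      { refl = ≤-refl , ≤-refl
      ; sym = λ (p , q) → q , p
      ; trans = λ (p , q) (p′ , q′) → ≤-trans p p′ , ≤-trans q′ q
      }
    }

  <-irrefl : ∀ {s t} → s ≈ t → ¬ s < t
  <-irrefl = wf⇒irrefl
    ((λ (p , _) q → <-≤-trans q p) , (λ (_ , p) q → ≤-<-trans p q))
    (Setoid.sym κ) <-wellFounded

  -- Whatever lies below `sup f` is either equal to it, the piece `nothing`, or below some branch
  -- `f y`, the piece `just y`, which embeds by induction.
  segment-≼ : ∀ t → ⟦ κ ∣ _≤ t ⟧ ≼ Y
  segment-≼ zero    =
    subsingleton-≼ _ Y (λ (_ , p) (_ , q) → ≤-trans p _ , ≤-trans q _) nil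
  segment-≼ (sup f) = union-≼ _ P P-resp cover small
    where
    P : Maybe Tree → Pred (∃ (_≤ sup f)) ℓ
    P nothing  (s , _) = s ≈ sup f
    P (just y) (s , _) = s ≤ f y

    P-resp : ∀ m {z z′} → (_≈_ on proj₁) z z′ → P m z → P m z′
    P-resp nothing z≈z′ z≈t = Setoid.trans κ (Setoid.sym κ z≈z′) z≈t
    P-resp (just _) z≈z′ z≤f = ≤-trans (proj₂ z≈z′) z≤f

    cover : ∀ z → ∃ λ m → P m z
    cover (s , s≤t) with ≤-total (sup f) s
    ... | inj₁ t≤s       = nothing , s≤t , t≤s
    ... | inj₂ (y , s≤f) = just y , s≤f

    small : ∀ m → ⟦ ⟦ κ ∣ _≤ sup f ⟧ ∣ P m ⟧ ≼ Y
    small nothing  = subsingleton-≼ _ Y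
      (λ (_ , p) (_ , q) → Setoid.trans κ p (Setoid.sym κ q)) nil
    small (just y) = ≼-trans
      (record { to = λ ((s , _) , s≤f) → s , s≤f ; cong = id ; injective = id })
      (segment-≼ (f y))

  -- The Burali-Forti argument: given an embedding, a single supremum over all trees, taken of
  -- chosen preimages, lies above every ordinal and so above itself.
  κ⋠Y : ¬ κ ≼ Y
  κ⋠Y g = <-irrefl (Setoid.refl κ) (bounded t)
    where
    preimage : Tree → Pred Ord ℓ
    preimage y s = Injection.to g s ≡ y

    t : Ord
    t = sup (λ y → choose zero (preimage y))

    bounded : ∀ s → s < t
    bounded s = Injection.to g s , proj₁ (Injection.injective g
      (≡.sym (choose-∈ zero (preimage (Injection.to g s)) (s , refl))))

  comparable : (I : Setoid ℓ ℓ) → κ ≼ I ⊎ ∃ λ t → I ≼ ⟦ κ ∣ _< t ⟧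
  comparable I with em {P = Carrier I}
  ... | no ¬I = inj₂ (zero , empty-≼ I _ ¬I)
  ... | yes i₀ = result
    where
    open Setoid I using () renaming (_≈_ to _≈ᴵ_)

    Avoids : (t : Ord) → WfRec _<_ (const (Carrier I)) t → Pred (Carrier I) ℓ
    Avoids t rec i = ∀ {s} (s<t : s < t) → ¬ rec s<t ≈ᴵ i

    step : (t : Ord) → WfRec _<_ (const (Carrier I)) t → Carrier I
    step t rec = choose i₀ (Avoids t rec)

    -- Needed to unfold the recursion. It holds because `choose` depends only on which elements are
    -- avoided.
    step-ext : ∀ t {rec rec′ : WfRec _<_ (const (Carrier I)) t} →
               (∀ {s} s<t → rec {s} s<t ≡ rec′ s<t) → step t rec ≡ step t rec′
    step-ext t rec≡rec′ = choose-cong i₀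
      ( (λ av s<t → av s<t ∘ Setoid.trans I (Setoid.reflexive I (rec≡rec′ s<t)))
      , (λ av s<t → av s<t ∘
          Setoid.trans I (Setoid.reflexive I (≡.sym (rec≡rec′ s<t)))))

    f : Ord → Carrier I
    f = All.wfRec <-wellFounded ℓ (const (Carrier I)) step

    Fresh : Ord → Pred (Carrier I) ℓ
    Fresh t = Avoids t (λ {s} _ → f s)

    f-unfold : ∀ t → f t ≡ choose i₀ (Fresh t)
    f-unfold t = FixPoint.unfold-wfRec <-wellFounded (const (Carrier I)) step step-ext

    f-cong : ∀ {s t} → s ≈ t → f s ≡ f t
    f-cong {s} {t} (s≤t , t≤s) = begin
      f s                 ≡⟨ f-unfold s ⟩
      choose i₀ (Fresh s) ≡⟨ choose-cong i₀
        ( (λ av r<t → av (<-≤-trans r<t t≤s))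
        , (λ av r<s → av (<-≤-trans r<s s≤t))) ⟩
      choose i₀ (Fresh t) ≡⟨ f-unfold t ⟨
      f t                 ∎
      where open ≡.≡-Reasoning

    result : κ ≼ I ⊎ ∃ λ t → I ≼ ⟦ κ ∣ _< t ⟧
    result with em {P = ∃ λ t → ¬ ∃ (Fresh t)}
    -- The stage `t` need not be the first exhausted one. Values of `f` may repeat below it, but
    -- each element of `I` is such a value, and choosing a preimage gives the embedding.
    ... | yes (t , exhausted) = inj₂ (t , choice-≼ I _
      (λ i (s , _) → f s ≈ᴵ i)
      (λ i≈j fs≈i → Setoid.trans I fs≈i i≈j)
      (λ i → by-contradiction λ none →
        exhausted (i , λ s<t fs≈i → none ((_ , s<t) , fs≈i)))
      λ fs≈i fs′≈i′ s≈s′ → Setoid.trans I (Setoid.sym I fs≈i)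
        (Setoid.trans I (Setoid.reflexive I (f-cong s≈s′)) fs′≈i′))
    ... | no inexhaustible = inj₁ (record
      { to = f
      ; cong = Setoid.reflexive I ∘ f-cong
      ; injective = λ fs≈ft →
          ≮⇒≥ (λ t<s → fresh t<s (Setoid.sym I fs≈ft)) ,
          ≮⇒≥ (λ s<t → fresh s<t fs≈ft)
      })
      where
      fresh : ∀ {s t} → s < t → ¬ f s ≈ᴵ f t
      fresh {s} {t} = ≡.subst (_∈ Fresh t) (≡.sym (f-unfold t))
        (choose-∈ i₀ (Fresh t)
          (by-contradiction λ none → inexhaustible (t , none)))

      ≮⇒≥ : ∀ {s t} → ¬ t < s → s ≤ t
      ≮⇒≥ {s} {t} t≮s = [ id , (λ t<s → contradiction t<s t≮s) ]′ (≤-total s t)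

  <-segment-≼ : ∀ t → ⟦ κ ∣ _< t ⟧ ≼ Y
  <-segment-≼ t = ≼-trans (subset-mono κ <⇒≤) (segment-≼ t)

  ≺κ⇒≼Y : (I : Setoid ℓ ℓ) → I ≺ κ → I ≼ Y
  ≺κ⇒≼Y I (_ , κ⋠I) with comparable I
  ... | inj₁ κ≼I       = contradiction κ≼I κ⋠I
  ... | inj₂ (t , I≼t) = ≼-trans I≼t (<-segment-≼ t)

  Y≺κ : Y ≺ κ
  Y≺κ with comparable Y
  ... | inj₁ κ≼Y       = contradiction κ≼Y κ⋠Y
  ... | inj₂ (t , Y≼t) = ≼-trans Y≼t (subset-≼ κ _) , κ⋠Y

  X≺κ : X ≺ κ
  X≺κ = ≼-≺-trans X≼Y Y≺κ

  κ-regular : IsRegular κ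
  κ-regular = record
    { infinite = ≼-trans ω₀≼Y (proj₁ Y≺κ)
    ; regular = λ I I≺κ f fibres≺κ → κ⋠Y (κ≼Y I (≺κ⇒≼Y I I≺κ) f fibres≺κ)
    }
    where
    κ≼Y : (I : Setoid ℓ ℓ) → I ≼ Y → (f : Func κ I) →
          (∀ i → fibre f i ≺ κ) → κ ≼ Y
    κ≼Y I h f fibres≺κ = union-≼ κ (λ m s → m ≡ just (label s)) (λ _ → label-resp)
      (λ s → just (label s) , refl) small
      where
      label : Ord → Tree
      label = Injection.to h ∘ Func.to f

      label-resp : ∀ {m s s′} → s ≈ s′ → m ≡ just (label s) → m ≡ just (label s′)
      label-resp s≈s′ eq =
        ≡.trans eq (cong just (Injection.cong h (Func.cong f s≈s′)))

      -- An index that labels nothing, such as `nothing`, has an empty piece; any other piece lies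
      -- in one fibre of `f`, as `h` is injective.
      small : ∀ m → ⟦ κ ∣ (λ s → m ≡ just (label s)) ⟧ ≼ Y
      small m with em {P = ∃ λ s → m ≡ just (label s)}
      ... | no empty = empty-≼ _ Y empty
      ... | yes (s₀ , refl) = ≼-trans
        (subset-mono κ λ eq → Setoid.sym I (Injection.injective h (just-injective eq)))
        (≺κ⇒≼Y (fibre f (Func.to f s₀)) (fibres≺κ (Func.to f s₀)))
        where open import Data.Maybe.Properties using (just-injective)

-- Small subsets of a regular cardinal, and sets below the first infinite one.

module _ {ℓ : Level} (C : Classical) where
  open Choice {ℓ} C

  -- Regularity speaks of maps out of `μ` itself. An embedding `g` of `μ` into the union yields such
  -- a map by choosing a piece that contains each `g x`, and `g` embeds its fibres into the pieces.
  smallUnion : (μ I : Setoid ℓ ℓ) → IsRegular μ → I ≺ μ →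
               (P : Carrier I → Pred (Carrier μ) ℓ) →
               (∀ {i j} → Setoid._≈_ I i j → P i ⊆ P j) →
               (∀ i → ¬ μ ≼ ⟦ μ ∣ P i ⟧) → ¬ μ ≼ ⟦ μ ∣ (λ x → ∃ λ i → P i x) ⟧
  smallUnion μ I μ-regular I≺μ P P-resp small g =
    let f , f∈ , f-cong = choice μ R R-resp total

        h : Func μ I
        h = record
          { to = proj₁ ∘ f ; cong = Setoid.reflexive I ∘ cong proj₁ ∘ f-cong }

        fibre-≼ : ∀ i → fibre h i ≼ ⟦ μ ∣ P i ⟧
        fibre-≼ i = record
          { to = λ (x , hx≈i) → proj₂ (f x) , P-resp hx≈i (proj₁ (f∈ x))
          ; cong = λ {x} {x′} x≈x′ →
              Setoid.reflexive μ (cong proj₂ (f-cong x≈x′))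
          ; injective = λ {x} {x′} y≈y′ → Injection.injective g
              (trans (sym (proj₂ (f∈ (proj₁ x))))
                (trans y≈y′ (proj₂ (f∈ (proj₁ x′)))))
          }
    in IsRegular.regular μ-regular I I≺μ h
      (λ i → subset-≼ μ _ , λ μ≼fibre → small i (≼-trans μ≼fibre (fibre-≼ i)))
    where
    open Setoid μ using (_≈_; sym; trans)

    -- `P i` need not respect the equality of `μ`, so an actual member `y` equal to `g x` is chosen
    -- together with the index.
    R : Carrier μ → Pred (Carrier I × Carrier μ) ℓ
    R x (i , y) = P i y × y ≈ proj₁ (Injection.to g x)

    R-resp : ∀ {x x′} → x ≈ x′ → R x ⊆ R x′
    R-resp x≈x′ (y∈ , y≈gx) = y∈ , trans y≈gx (Injection.cong g x≈x′)

    total : ∀ x → ∃ (R x)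
    total x = let y , i , y∈ = Injection.to g x in (i , y) , y∈ , Setoid.refl μ

  two : Setoid ℓ ℓ
  two = ≡.setoid (Lift ℓ Bool)

  two≺infinite : (μ : Setoid ℓ ℓ) → ω₀ ≼ μ → two ≺ μ
  two≺infinite μ ω₀≼μ =
    ≼-trans two≼ω₀ ω₀≼μ , λ μ≼two → ω₀⋠two (≼-trans ω₀≼μ μ≼two)
    where
    two≼ω₀ : two ≼ ω₀
    two≼ω₀ = record
      { to = λ b → lift (if lower b then 1 else 0)
      ; cong = cong _
      ; injective = λ
        { {lift false} {lift false} _ → refl
        ; {lift true}  {lift true}  _ → refl
        }
      }

    pigeonhole : (a b c : Bool) → a ≡ b ⊎ a ≡ c ⊎ b ≡ c
    pigeonhole false false _     = inj₁ refl
    pigeonhole true  true  _     = inj₁ refl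
    pigeonhole false true  false = inj₂ (inj₁ refl)
    pigeonhole false true  true  = inj₂ (inj₂ refl)
    pigeonhole true  false false = inj₂ (inj₂ refl)
    pigeonhole true  false true  = inj₂ (inj₁ refl)

    ω₀⋠two : ¬ ω₀ ≼ two
    ω₀⋠two f with pigeonhole (bit 0) (bit 1) (bit 2)
      where
      bit : ℕ → Bool
      bit n = lower (Injection.to f (lift n))
    ... | inj₁ eq        with () ← Injection.injective f (cong lift eq)
    ... | inj₂ (inj₁ eq) with () ← Injection.injective f (cong lift eq)
    ... | inj₂ (inj₂ eq) with () ← Injection.injective f (cong lift eq)

  module Small {μ : Setoid ℓ ℓ} (μ-regular : IsRegular μ) where
    open IsRegular μ-regular

    -- Every subset of `μ` embeds in `μ`, so containing no copy of `μ` already means cardinality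
    -- below `μ`.
    IsSmall : Pred (Carrier μ) ℓ → Set ℓ
    IsSmall P = ¬ μ ≼ ⟦ μ ∣ P ⟧

    small-⊆ : ∀ {P Q} → P ⊆ Q → IsSmall Q → IsSmall P
    small-⊆ P⊆Q Q-small μ≼P = Q-small (≼-trans μ≼P (subset-mono μ P⊆Q))

    full-notSmall : ∀ {P} → (∀ x → x ∈ P) → ¬ IsSmall P
    full-notSmall full P-small =
      P-small (record { to = λ x → x , full x ; cong = id ; injective = id })

    subsingleton-small : ∀ {P} → (∀ {x y} → x ∈ P → y ∈ P → Setoid._≈_ μ x y) →
                         IsSmall P
    subsingleton-small {P} all≈ μ≼P = distinct (≼-trans infinite μ≼P)
      where
      distinct : ¬ ω₀ ≼ ⟦ μ ∣ P ⟧
      distinct f with () ← Injection.injective f {lift 0} {lift 1}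
        (all≈ (proj₂ (Injection.to f (lift 0))) (proj₂ (Injection.to f (lift 1))))

    ∪-small : ∀ {P Q} → IsSmall P → IsSmall Q → IsSmall (λ x → x ∈ P ⊎ x ∈ Q)
    ∪-small {P} {Q} P-small Q-small = small-⊆
      [ (λ x∈P → lift true , x∈P) , (λ x∈Q → lift false , x∈Q) ]′
      (smallUnion μ two μ-regular (two≺infinite μ infinite) R (λ { refl → id })
        λ { (lift true) → P-small ; (lift false) → Q-small })
      where
      R : Lift ℓ Bool → Pred (Carrier μ) ℓ
      R (lift b) = if b then P else Q

  -- If the ranks were unbounded, repeatedly passing to an element of larger rank would embed `ω₀`
  -- in `I`.
  ≺ω₀-bounded : (I : Setoid ℓ ℓ) ((f , _) : I ≺ ω₀) →
                ∃ λ n → ∀ i → lower (Injection.to f i) ℕ.< n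
  ≺ω₀-bounded I (f , ω₀⋠I) = by-contradiction λ unbounded →
    let
      above : ∀ n → ∃ λ i → n ℕ.≤ rank i
      above n = by-contradiction λ none → unbounded (n , λ i →
        ℕ.≰⇒> λ n≤i → none (i , n≤i))
    in ω₀⋠I (record
      { to = climb above ∘ lower
      ; cong = Setoid.reflexive I ∘ cong (climb above ∘ lower)
      ; injective = cong lift ∘ climb-injective above ∘
          cong lower ∘ Injection.cong f
      })
    where
    rank : Carrier I → ℕ
    rank = lower ∘ Injection.to f

    module _ (above : ∀ n → ∃ λ i → n ℕ.≤ rank i) where
      climb : ℕ → Carrier I
      climb zero    = proj₁ (above 0)
      climb (suc n) = proj₁ (above (suc (rank (climb n))))

      climb-mono : ∀ {m n} → m ℕ.< n → rank (climb m) ℕ.< rank (climb n)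
      climb-mono {m} {suc n} (ℕ.s≤s m≤n) with ℕ.m≤n⇒m<n∨m≡n m≤n
      ... | inj₁ m<n  = ℕ.<-trans (climb-mono m<n) (proj₂ (above _))
      ... | inj₂ refl = proj₂ (above _)

      climb-injective : ∀ {m n} → rank (climb m) ≡ rank (climb n) → m ≡ n
      climb-injective {m} {n} eq with ℕ.<-cmp m n
      ... | tri< m<n _ _ = contradiction eq (ℕ.<⇒≢ (climb-mono m<n))
      ... | tri≈ _ m≡n _ = m≡n
      ... | tri> _ _ n<m = contradiction (≡.sym eq) (ℕ.<⇒≢ (climb-mono n<m))

-- Distributive joins and the inclusions between the classes.

module _ {ℓ : Level} (A : BoundedDistributiveLattice ℓ ℓ ℓ) where
  open BoundedDistributiveLattice A renaming (_∨_ to _⊔_; _∧_ to _⊓_)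
    hiding (Carrier; refl; trans)
  open Joins A
  open Poset poset using () renaming (refl to ≤-refl; trans to ≤-trans)
  open MeetSemilatticeProperties meetSemilattice using (∧-monotonic)

  private
    L : Set ℓ
    L = BoundedDistributiveLattice.Carrier A

  -- Monotonicity of meets gives the upper-bound half, so only leastness has to be supplied.
  distributive : ∀ {S j} → IsJoin S j →
                 (∀ a u → (∀ {s} → s ∈ S → a ⊓ s ≤ u) → a ⊓ j ≤ u) →
                 IsDistributiveJoin S j
  distributive join below a = record
    { upper = λ (s , s∈S , x≈a⊓s) → ≤-trans (reflexive x≈a⊓s)
        (∧-monotonic ≤-refl (IsJoin.upper join s∈S))
    ; least = λ bound → below a _ λ s∈S → bound (_ , s∈S , Setoid.refl setoid)
    }

  distributive-least : ∀ {S j} → IsDistributiveJoin S j →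
                       ∀ a u → (∀ {s} → s ∈ S → a ⊓ s ≤ u) → a ⊓ j ≤ u
  distributive-least dist a u bound = IsJoin.least (dist a)
    λ (s , s∈S , x≈a⊓s) → ≤-trans (reflexive x≈a⊓s) (bound s∈S)

  -- Bridges the two kinds of class: `-Frm` provides some distributive join, while `-JD` asks about
  -- an arbitrary one.
  distributive-unique : ∀ {S i j} → IsJoin S i → IsDistributiveJoin S i →
                        IsJoin S j → IsDistributiveJoin S j
  distributive-unique i-join i-dist j-join = distributive j-join λ a u bound →
    ≤-trans
      (∧-monotonic ≤-refl (IsJoin.least j-join (IsJoin.upper i-join)))
      (distributive-least i-dist a u bound)

  Frm⊆JD : (κ : Setoid ℓ ℓ) → A ∈ κ -Frm → A ∈ κ -JD
  Frm⊆JD κ A∈Frm S S≺κ j j-join =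
    let i , i-join , i-dist = A∈Frm S S≺κ in
    distributive-unique i-join i-dist j-join

  JD-antitone : {μ κ : Setoid ℓ ℓ} → μ ≼ κ → A ∈ κ -JD → A ∈ μ -JD
  JD-antitone μ≼κ A∈JD S S≺μ = A∈JD S (≺-≼-trans S≺μ μ≼κ)

  Frm-antitone : {μ κ : Setoid ℓ ℓ} → μ ≼ κ → A ∈ κ -Frm → A ∈ μ -Frm
  Frm-antitone μ≼κ A∈Frm S S≺μ = A∈Frm S (≺-≼-trans S≺μ μ≼κ)

  module _ (C : Classical) where
    open Choice {ℓ} C

    -- Induction on a bound for the ranks of the elements of `S`, with the distributive inequality
    -- carried along; each step adds at most one element.
    ω₀-frame : A ∈ ω₀ -Frm
    ω₀-frame S S≺ω₀@(f , _) =
      let n , bounded = ≺ω₀-bounded C ⟦ setoid ∣ S ⟧ S≺ω₀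
          j , join , below = finiteJoin n
          S-join : IsJoin S j
          S-join = record
            { upper = λ s∈S → IsJoin.upper join (s∈S , bounded _)
            ; least = λ bound → IsJoin.least join λ (s∈S , _) → bound s∈S
            }
      in j , S-join , distributive S-join λ a u bound →
           below a u λ (s∈S , _) → bound s∈S
      where
      rank : ∃ S → ℕ
      rank = lower ∘ Injection.to f

      Below : ℕ → Pred L ℓ
      Below n s = ∃ λ (s∈S : s ∈ S) → rank (s , s∈S) ℕ.< n

      grow : ∀ {n} → Below n ⊆ Below (suc n)
      grow (s∈S , r<n) = s∈S , ℕ.m<n⇒m<1+n r<n

      finiteJoin : ∀ n → ∃ λ j → IsJoin (Below n) j ×
        (∀ a u → (∀ {s} → s ∈ Below n → a ⊓ s ≤ u) → a ⊓ j ≤ u)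
      finiteJoin zero =
        ⊥ ,
        record { upper = λ () ; least = λ _ → minimum _ } ,
        λ a u _ → ≤-trans (x∧y≤y a ⊥) (minimum u)
      finiteJoin (suc n)
        with finiteJoin n | em {P = ∃ λ z → rank z ≡ n}
      ... | j , join , below | no none =
        j ,
        record
          { upper = λ s∈ → IsJoin.upper join (shrink s∈)
          ; least = λ bound → IsJoin.least join (bound ∘ grow)
          } ,
        λ a u bound → below a u (bound ∘ grow)
        where
        shrink : Below (suc n) ⊆ Below n
        shrink (s∈S , ℕ.s≤s r≤n) =
          s∈S , ℕ.≤∧≢⇒< r≤n (λ r≡n → none (_ , r≡n))
      ... | j , join , below | yes ((t , t∈S) , refl) =
        j ⊔ t ,
        record
          { upper = λ s∈ → upper′ s∈
          ; least = λ bound → ∨-least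
              (IsJoin.least join (bound ∘ grow)) (bound t∈)
          } ,
        λ a u bound → ≤-trans (reflexive (∧-distribˡ-∨ a j t))
          (∨-least (below a u (bound ∘ grow)) (bound t∈))
        where
        t∈ : t ∈ Below (suc n)
        t∈ = t∈S , ℕ.n<1+n _

        -- An element of rank exactly `n` equals `t`, because the rank is injective.
        upper′ : ∀ {s} → s ∈ Below (suc n) → s ≤ j ⊔ t
        upper′ (s∈S , ℕ.s≤s r≤n) with ℕ.m≤n⇒m<n∨m≡n r≤n
        ... | inj₁ r<n = ≤-trans (IsJoin.upper join (s∈S , r<n)) (x≤x∨y j t)
        ... | inj₂ r≡n = ≤-trans
          (reflexive (Injection.injective f (cong lift r≡n))) (y≤x∨y j t)

    ⋂JD⊆JID : A ∈ ⋂ (RegularCardinal ℓ) (λ κ → proj₁ κ -JD) → A ∈ JID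
    ⋂JD⊆JID A∈JD S = A∈JD (κ , κ-regular) S X≺κ
      where open Hartogs C ⟦ setoid ∣ S ⟧ using (κ; κ-regular; X≺κ)

    ⋂Frm⊆Frm : A ∈ ⋂ (RegularCardinal ℓ) (λ κ → proj₁ κ -Frm) → A ∈ Frm
    ⋂Frm⊆Frm A∈Frm S = A∈Frm (κ , κ-regular) S X≺κ
      where open Hartogs C ⟦ setoid ∣ S ⟧ using (κ; κ-regular; X≺κ)

-- Rings of sets.

setLattice : ∀ {ℓ} {X : Set ℓ} (F : Pred (X → Bool) ℓ) →
             F (const true) → F (const false) →
             (∀ {f g} → F f → F g → F (λ x → f x ∧ g x)) →
             (∀ {f g} → F f → F g → F (λ x → f x ∨ g x)) →
             BoundedDistributiveLattice ℓ ℓ ℓ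
setLattice F F-true F-false F-∧ F-∨ = record
  -- Subsets are Boolean-valued because arbitrary predicates would raise the universe level of the
  -- carrier.
  { Carrier = ∃ F
  ; _≈_ = λ f g → f ⊑ g × g ⊑ f
  ; _≤_ = _⊑_
  ; _∨_ = λ (f , Ff) (g , Fg) → (λ x → f x ∨ g x) , F-∨ Ff Fg
  ; _∧_ = λ (f , Ff) (g , Fg) → (λ x → f x ∧ g x) , F-∧ Ff Fg
  ; ⊤ = const true , F-true
  ; ⊥ = const false , F-false
  ; isBoundedLattice = record
    { isLattice = record
      { isPartialOrder = record
        { isPreorder = record
          { isEquivalence = record
            { refl = (λ _ → id) , λ _ → id
            ; sym = λ (p , q) → q , p
            ; trans = λ (p , q) (p′ , q′) →
                (λ x → p′ x ∘ p x) , λ x → q x ∘ q′ x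
            }
          ; reflexive = proj₁
          ; trans = λ p q x → q x ∘ p x
          }
        ; antisym = _,_
        }
      ; supremum = λ f g →
          (λ x → ∨⁺ {x = proj₁ f x} ∘ inj₁) ,
          (λ x → ∨⁺ {x = proj₁ f x} ∘ inj₂) ,
          λ h p q x → [ p x , q x ]′ ∘ ∨⁻
      ; infimum = λ f g →
          (λ x → proj₁ ∘ ∧⁻) ,
          (λ x → proj₂ ∘ ∧⁻ {x = proj₁ f x}) ,
          λ h p q x t → ∧⁺ (p x t , q x t)
      }
    ; maximum = _
    ; minimum = λ _ _ ()
    }
  ; ∧-distribˡ-∨ = λ f g h →
      (λ x → ≡.subst T (Bool.∧-distribˡ-∨ (proj₁ f x) (proj₁ g x) (proj₁ h x))) ,
      λ x → ≡.subst T
        (≡.sym (Bool.∧-distribˡ-∨ (proj₁ f x) (proj₁ g x) (proj₁ h x)))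
  }
  where
  _⊑_ : Rel (∃ F) _
  f ⊑ g = ∀ x → T (proj₁ f x) → T (proj₁ g x)

-- A frame for `μ` in which a join of at most `μ` elements is not distributive.

module SmallOrFull {ℓ : Level} (C : Classical) {μ : Setoid ℓ ℓ}
                   (μ-regular : IsRegular μ) where
  open Choice {ℓ} C
  open Small C μ-regular
  open Setoid μ using (_≈_; sym; trans)

  Elements : (Carrier μ → Bool) → Pred (Carrier μ) ℓ
  Elements f x = Lift ℓ (T (f x))

  SmallOrFull : Pred (Carrier μ → Bool) ℓ
  SmallOrFull f = IsSmall (Elements f) ⊎ (∀ x → T (f x))

  lattice : BoundedDistributiveLattice ℓ ℓ ℓ
  lattice = setLattice SmallOrFull
    (inj₂ _) (inj₁ (subsingleton-small λ { (lift ()) })) F-∧ F-∨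
    where
    F-∧ : ∀ {f g} → SmallOrFull f → SmallOrFull g → SmallOrFull (λ x → f x ∧ g x)
    F-∧ (inj₁ f-small) _ = inj₁ (small-⊆ (λ (lift t) → lift (proj₁ (∧⁻ t))) f-small)
    F-∧ {f} (inj₂ _) (inj₁ g-small) = inj₁ (small-⊆
      (λ {x} (lift t) → lift (proj₂ (∧⁻ {x = f x} t))) g-small)
    F-∧ (inj₂ f-full) (inj₂ g-full) = inj₂ λ x → ∧⁺ (f-full x , g-full x)

    F-∨ : ∀ {f g} → SmallOrFull f → SmallOrFull g → SmallOrFull (λ x → f x ∨ g x)
    F-∨ (inj₁ f-small) (inj₁ g-small) = inj₁ (small-⊆
      (λ (lift t) → Sum.map lift lift (∨⁻ t)) (∪-small f-small g-small))
    F-∨ {f} (inj₁ _) (inj₂ g-full) = inj₂ λ x → ∨⁺ {x = f x} (inj₂ (g-full x))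
    F-∨ (inj₂ f-full) _ = inj₂ λ x → ∨⁺ (inj₁ (f-full x))

  open BoundedDistributiveLattice lattice using (setoid)
    renaming (Carrier to L; _≤_ to _⊑_)
  open Joins lattice

  -- Joins are unions: full if some member is full, and otherwise a union of fewer than `μ` small
  -- sets, small by regularity. Unions distribute pointwise.
  isFrame : lattice ∈ μ -Frm
  isFrame S S≺μ = (χ ⋃S , ⋃S-smallOrFull) , join , distributive lattice join
    λ (a , _) u bound x x∈a⊓⋃ →
      let x∈a , x∈⋃ = ∧⁻ {x = a x} x∈a⊓⋃
          s , s∈S , x∈s = T-χ⁻ ⋃S x∈⋃
      in bound s∈S x (∧⁺ (x∈a , x∈s))
    where
    ⋃S : Pred (Carrier μ) ℓ
    ⋃S x = ∃ λ s → s ∈ S × T (proj₁ s x)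

    ⋃S-smallOrFull : SmallOrFull (χ ⋃S)
    ⋃S-smallOrFull with em {P = ∃ λ s → s ∈ S × (∀ x → T (proj₁ s x))}
    ... | yes (s , s∈S , full) = inj₂ λ x → T-χ⁺ ⋃S (s , s∈S , full x)
    ... | no none = inj₁ (small-⊆
      (λ (lift x∈⋃) →
        let s , s∈S , x∈s = T-χ⁻ ⋃S x∈⋃ in (s , s∈S) , lift x∈s)
      (smallUnion C μ ⟦ setoid ∣ S ⟧ μ-regular S≺μ (λ (s , _) → Elements (proj₁ s))
        (λ (s⊑t , _) {x} (lift x∈s) → lift (s⊑t x x∈s))
        λ ((_ , smallOrFull) , s∈S) →
          [ id , (λ full → contradiction (_ , s∈S , full) none) ]′ smallOrFull))

    join : IsJoin S (χ ⋃S , ⋃S-smallOrFull)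
    join = record
      { upper = λ s∈S x x∈s → T-χ⁺ ⋃S (_ , s∈S , x∈s)
      ; least = λ bound x x∈⋃ →
          let s , s∈S , x∈s = T-χ⁻ ⋃S x∈⋃ in bound s∈S x x∈s
      }

  singleton : Carrier μ → L
  singleton x = χ (x ≈_) , inj₁ (subsingleton-small λ (lift y∈) (lift z∈) →
    trans (sym (T-χ⁻ (x ≈_) y∈)) (T-χ⁻ (x ≈_) z∈))

  notJD : (κ : Setoid ℓ ℓ) → μ ≺ κ → ¬ lattice ∈ κ -JD
  notJD κ μ≺κ lattice∈JD = contradiction
    -- Distributivity would put the meet of `singleton p` with `⊤` below `⊥`; at the point `p` this
    -- is a proof of `T false`.
    (distributive-least lattice
      (lattice∈JD S (≼-≺-trans S≼μ μ≺κ) ⊤ ⊤-join) (singleton p) ⊥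
      (λ {s} → disjoint {s})
      p (∧⁺ (T-χ⁺ (p ≈_) (Setoid.refl μ) , _)))
    id
    where
    open BoundedDistributiveLattice lattice using (⊤; ⊥) renaming (_∧_ to _⊓_)

    p : Carrier μ
    p = Injection.to (IsRegular.infinite μ-regular) (lift 0)

    S : Pred L ℓ
    S s = ∃ λ x → ¬ p ≈ x × Setoid._≈_ setoid s (singleton x)

    S≼μ : ⟦ setoid ∣ S ⟧ ≼ μ
    S≼μ = ≼-trans (subset-mono setoid λ (x , _ , s≈x) → x , s≈x)
      (image-≼ μ setoid singleton
        (λ {x} {y} x≈y →
          (λ z → T-χ⁺ (y ≈_) ∘ trans (sym x≈y) ∘ T-χ⁻ (x ≈_)) ,
          (λ z → T-χ⁺ (x ≈_) ∘ trans x≈y ∘ T-χ⁻ (y ≈_)))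
        (λ {x} {y} (_ , y⊑x) →
          T-χ⁻ (x ≈_) (y⊑x y (T-χ⁺ (y ≈_) (Setoid.refl μ)))))

    -- An upper bound contains every point but perhaps `p`. Were it small, adding `p` would make all
    -- of `μ` small; hence it is full.
    ⊤-join : IsJoin S ⊤
    ⊤-join = record
      { upper = λ _ _ _ → _
      ; least = λ {u} bound →
          let contains : ∀ x → ¬ p ≈ x → T (proj₁ u x)
              contains x p≉x = bound {singleton x}
                (x , p≉x , Setoid.refl setoid {singleton x}) x (T-χ⁺ (x ≈_) (Setoid.refl μ))
          in [ (λ u-small → contradiction
                 (∪-small {P = p ≈_} {Q = Elements (proj₁ u)}
                   (subsingleton-small {P = p ≈_} λ p≈x p≈y → trans (sym p≈x) p≈y)
                   u-small)
                 (full-notSmall λ x → Sum.map₂ (lift ∘ contains x) (toSum em)))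
             , (λ full x _ → full x)
             ]′ (proj₂ u)
      }

    disjoint : ∀ {s} → s ∈ S → (singleton p ⊓ s) ⊑ ⊥
    disjoint (x , p≉x , s⊑x , _) y y∈ =
      let y∈p , y∈s = ∧⁻ {x = χ (p ≈_) y} y∈ in
      p≉x (trans (T-χ⁻ (p ≈_) y∈p) (sym (T-χ⁻ (x ≈_) (s⊑x y y∈s))))

-- A Boolean algebra lacking a countable join.

module EventuallyConstant {ℓ : Level} (C : Classical) where
  open Choice {ℓ} C

  Point : Set ℓ
  Point = Lift ℓ (ℕ × Bool)

  -- Both copies of `ℕ` share the eventual value `c`; this keeps a set from separating them beyond
  -- its threshold.
  EventuallyConstant : Pred (Point → Bool) ℓ
  EventuallyConstant f = Lift ℓ (∃₂ λ n c → ∀ {m} b → n ℕ.≤ m → f (lift (m , b)) ≡ c)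

  private
    pointwise : (_∙_ : Bool → Bool → Bool) → ∀ {f g} →
                EventuallyConstant f → EventuallyConstant g →
                EventuallyConstant (λ x → f x ∙ g x)
    pointwise _∙_ (lift (m , c , f≡c)) (lift (n , d , g≡d)) = lift
      ( m ℕ.⊔ n , c ∙ d
      , λ b m⊔n≤k → ≡.cong₂ _∙_ (f≡c b (ℕ.m⊔n≤o⇒m≤o m n m⊔n≤k))
                                (g≡d b (ℕ.m⊔n≤o⇒n≤o m n m⊔n≤k)))

  lattice : BoundedDistributiveLattice ℓ ℓ ℓ
  lattice = setLattice EventuallyConstant
    (lift (0 , true , λ _ _ → refl)) (lift (0 , false , λ _ _ → refl))
    (pointwise _∧_) (pointwise _∨_)

  open BoundedDistributiveLattice lattice using (setoid)
    renaming (Carrier to L; _≤_ to _⊑_; _∧_ to _⊓_; _∨_ to _⊔_)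
  open Joins lattice

  complement : L → L
  complement (f , lift (n , c , f≡c)) =
    not ∘ f , lift (n , not c , λ b n≤m → cong not (f≡c b n≤m))

  singleton : ℕ × Bool → L
  singleton (n , b) = χ (lift (n , b) ≡_) , lift (suc n , false , λ c n<m →
    ¬T⇒≡false (λ t → ℕ.<⇒≢ n<m (cong (proj₁ ∘ lower) (T-χ⁻ (lift (n , b) ≡_) t))))
    where
    ¬T⇒≡false : ∀ {x} → ¬ T x → x ≡ false
    ¬T⇒≡false {false} _  = refl
    ¬T⇒≡false {true}  ¬t = contradiction _ ¬t

  T-not : ∀ b → T b → ¬ T (not b)
  T-not true _ ()

  T-or-not : ∀ b → T b ⊎ T (not b)
  T-or-not true  = inj₁ _
  T-or-not false = inj₂ _

  -- Complements turn a bound `u` for the meets of `a` with members of `S` into the bound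
  -- `u ⊔ complement a` for `S` itself, hence for `j`; meeting with `a` again gives the claim.
  isJID : lattice ∈ JID
  isJID S j join = distributive lattice join λ a u bound x x∈a⊓j →
    let x∈a , x∈j = ∧⁻ {x = proj₁ a x} x∈a⊓j
        j⊑u⊔¬a : j ⊑ (u ⊔ complement a)
        j⊑u⊔¬a = IsJoin.least join {u ⊔ complement a} λ {s} s∈S y y∈s →
          ∨⁺ {x = proj₁ u y} (Sum.map₁ (λ y∈a → bound {s} s∈S y (∧⁺ (y∈a , y∈s)))
            (T-or-not (proj₁ a y)))
    in [ id , (λ x∈¬a → contradiction x∈¬a (T-not _ x∈a)) ]′
         (∨⁻ {x = proj₁ u x} (j⊑u⊔¬a x x∈j))

  TruePoints : Pred L ℓ
  TruePoints s = ∃ λ n → Setoid._≈_ setoid s (singleton (n , true))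

  -- At its threshold `n`, `j` contains `(n , true)` and therefore `(n , false)`. Removing the
  -- latter leaves an upper bound, which contradicts leastness.
  noJoin : ∀ j → ¬ IsJoin TruePoints j
  noJoin j@(f , lift (n , c , f≡c)) join = T-not (χ (x ≡_) x) (T-χ⁺ (x ≡_) refl)
    (proj₂ (∧⁻ {x = f x} (IsJoin.least join {j ⊓ complement (singleton (n , false))}
      (λ {s} → bound {s}) x
      (subst T (trans (f≡c true ℕ.≤-refl) (sym (f≡c false ℕ.≤-refl))) y∈j))))
    where
    open ≡ using (subst; trans; sym)

    x y : Point
    x = lift (n , false)
    y = lift (n , true)

    y∈j : T (f y)
    y∈j = IsJoin.upper join {singleton (n , true)}
      (n , Setoid.refl setoid {singleton (n , true)}) y (T-χ⁺ (y ≡_) refl)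

    bound : ∀ {s} → s ∈ TruePoints → s ⊑ (j ⊓ complement (singleton (n , false)))
    bound {s} (m , s⊑m , m⊑s) z z∈s = ∧⁺
      ( IsJoin.upper join {s} (m , s⊑m , m⊑s) z z∈s
      , [ (λ x≡z → contradiction
            (trans (T-χ⁻ (lift (m , true) ≡_) (s⊑m z z∈s)) (sym (T-χ⁻ (x ≡_) x≡z)))
            λ ())
        , id ]′ (T-or-not (χ (x ≡_) z)))

  notFrm : (κ : Setoid ℓ ℓ) → ω₀ ≺ κ → ¬ lattice ∈ κ -Frm
  notFrm κ ω₀≺κ lattice∈Frm =
    let j , join , _ = lattice∈Frm TruePoints (≼-≺-trans TruePoints≼ω₀ ω₀≺κ)
    in noJoin j join
    where
    TruePoints≼ω₀ : ⟦ setoid ∣ TruePoints ⟧ ≼ ω₀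
    TruePoints≼ω₀ = ≼-trans (subset-mono setoid λ (n , s≈n) → lift n , s≈n)
      (image-≼ ω₀ setoid (λ n → singleton (lower n , true))
        (λ { {m} refl → Setoid.refl setoid {singleton (lower m , true)} })
        (λ {m} {n} (_ , n⊑m) → cong (lift ∘ proj₁ ∘ lower)
          (T-χ⁻ (lift (lower m , true) ≡_)
            (n⊑m _ (T-χ⁺ (lift (lower n , true) ≡_) refl)))))

theorem4p1 : ∀ (ℓ : Level) → Classical →
    ((DLat {ℓ} ≐ ω₀ -JD) × (DLat {ℓ} ≐ ω₀ -Frm))
    ×
    (∀ (μ κ : Setoid ℓ ℓ) → IsRegular μ → IsRegular κ →
    (μ ≼ κ → (κ -JD ⊆ μ -JD) × (κ -Frm ⊆ μ -Frm))
    × (μ ≺ κ → (κ -JD ⊂ μ -JD) × (κ -Frm ⊂ μ -Frm)))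
    ×
    (∀ (κ : Setoid ℓ ℓ) → IsRegular κ →
    (κ -Frm ⊆ κ -JD)
    × (ω₀ ≺ κ → κ -Frm ⊂ κ -JD))
    ×
    ((JID {ℓ} ≐ ⋂ (RegularCardinal ℓ) (λ κ → proj₁ κ -JD))
    × (Frm {ℓ} ≐ ⋂ (RegularCardinal ℓ) (λ κ → proj₁ κ -Frm)))
theorem4p1 ℓ C =
  ( ( (λ {A} _ → Frm⊆JD A ω₀ (ω₀-frame A C)) , _)
  , ( (λ {A} _ → ω₀-frame A C) , _))
  , (λ μ κ μ-regular κ-regular →
      (λ μ≼κ → antitone μ≼κ)
      , λ μ≺κ@(μ≼κ , _) →
          -- One lattice refutes both converses: it lies in `μ -Frm`, hence in `μ -JD`, but not in
          -- `κ -JD`, hence not in `κ -Frm`.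
          let open SmallOrFull C μ-regular using (lattice; isFrame; notJD)
              JD⊆ , Frm⊆ = antitone μ≼κ
          in (JD⊆ , λ JD⊇ →
               notJD κ μ≺κ (JD⊇ {lattice} (Frm⊆JD lattice μ isFrame)))
           , (Frm⊆ , λ Frm⊇ →
               notJD κ μ≺κ (Frm⊆JD lattice κ (Frm⊇ {lattice} isFrame))))
  , (λ κ κ-regular →
      (λ {A} → Frm⊆JD A κ)
      , λ ω₀≺κ →
          let open EventuallyConstant C using (lattice; isJID; notFrm)
          in (λ {A} → Frm⊆JD A κ) , λ Frm⊇ →
               notFrm κ ω₀≺κ (Frm⊇ {lattice} λ S _ → isJID S))
  , ( ((λ A∈JID κ S _ → A∈JID S) , λ {A} → ⋂JD⊆JID A C)
    , ((λ A∈Frm κ S _ → A∈Frm S) , λ {A} → ⋂Frm⊆Frm A C))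
  where
  antitone : {μ κ : Setoid ℓ ℓ} → μ ≼ κ → (κ -JD ⊆ μ -JD) × (κ -Frm ⊆ μ -Frm)
  antitone μ≼κ = (λ {A} → JD-antitone A μ≼κ) , (λ {A} → Frm-antitone A μ≼κ)
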